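{- Let $D=DC(s,s',a,b)$ be a disjunctive double cycle and $\Delta$ a block-sequential update schedule over its automata. Let $A$ (respectively $B$) be the number of edges labelled $<$ on the cycle of size $a$ (respectively $b$) in the update digraph $G_U(D_\Delta)$. Then the limit dynamics of $D_\Delta$ is isomorphic (as a digraph) to the limit dynamics of $D'_\pi$, where $D'=DC(s,s',a-A,b-B)$ and $\pi$ is the parallel update schedule.
   Context: A Boolean automata network over a finite set $S$ of automata is a function $F:\{0,1\}^S\to\{0,1\}^S$ with local functions $f_i(x)=F(x)_i$. Automaton $i$ influences $j$ if there are configurations $x,x'$ that differ exactly at $i$ with $f_j(x)\neq f_j(x')$; the interaction digraph $G_I(F)$ has node set $S$ and an edge $(i,j)$ if and only if $i$ influences $j$. For $X\subseteq S$, $F_X(x)_i=f_i(x)$ if $i\in X$ and $F_X(x)_i=x_i$ otherwise. A block-sequential update schedule $\Delta=(X_0,\dots,X_p)$ is a finite sequence of non-empty subsets (blocks) of $S$ that form a partition of $S$, and $F_\Delta=F_{X_p}\circ\cdots\circ F_{X_0}$. The parallel update schedule is $\pi=(S)$, so $F_\pi=F$. The update digraph $G_U(F_\Delta)$ is the interaction digraph in which each edge $(u,v)$ is labelled $<$ if the block of $u$ occurs strictly before the block of $v$ in $\Delta$, and $\geqslant$ otherwise. The dynamics of $F_\Delta$ is the digraph on all configurations with an edge $(x,y)$ if and only if $F_\Delta(x)=y$. A limit cycle of length $k$ is a sequence of distinct configurations $(x_1,\dots,x_k)$ with $F_\Delta(x_i)=x_{i+1}$ for $1\le i<k$ and $F_\Delta(x_k)=x_1$;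 a fixed point is a limit cycle of length one. The limit dynamics of $F_\Delta$ is the subgraph of the dynamics containing only the limit cycles and fixed points. A disjunctive double cycle is a Boolean automata network whose interaction digraph is composed of two automata cycles that intersect in exactly one automaton (the central automaton), and whose central local function is a disjunctive clause: it is the disjunction of two literals, one for the predecessor of the central automaton on each cycle; every other local function is the identity or the negation of the predecessor's variable. (A cycle of size $1$ is a loop on the central automaton.) An edge $(u,v)$ is positive if $x_u$ appears as a positive variable in $f_v$ and negative if $x_u$ appears negated in $f_v$. A cycle is positive if it contains an even number of negative edges, and negative otherwise. $DC(s,s',a,b)$ denotes the disjunctive double cycles with cycles of sizes (numbers of automata) $a$ and $b$ and of signs $s$ and $s'$ respectively. -}

module Defs where

open import Data.Bool.Base using (Bool; true; false; not; _∨_; if_then_else_)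
open import Data.Bool.Properties using () renaming (_≟_ to _≟ᵇ_)
open import Data.Fin.Base using (Fin; zero; toℕ; _<_; _≥_)
open import Data.Fin.Properties using (_≟_; all?; _<?_; _≤?_; nonZeroIndex)
open import Data.Fin.Subset using (Subset; _∈_; ⊤; Nonempty)
open import Data.Fin.Subset.Properties using (_∈?_; ∈⊤)
open import Data.Nat.Base using (ℕ; zero; suc; NonZero; parity)
open import Data.Nat.DivMod using (_mod_)
open import Data.Parity.Base using (toSign)
open import Data.Product using (Σ; ∃; ∃-syntax; ∃!; _×_; _,_; proj₁; proj₂)
open import Data.Sign.Base using (Sign)
open import Data.Sign.Properties using () renaming (_≟_ to _≟ˢ_)
open import Data.Sum.Base using (_⊎_; inj₁; inj₂)
open import Data.Vec.Base using (Vec; []; _∷_; lookup; tabulate; foldl; count; allFin)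
open import Function.Base using (_∘_)
open import Function.Bundles using (Inverse; _⇔_)
open import Function.Definitions using (Injective)
open import Level using (0ℓ)
open import Relation.Binary.Bundles using (Setoid)
import Relation.Binary.Construct.On as On
open import Relation.Binary.PropositionalEquality using (_≡_; _≢_; refl)
import Relation.Binary.PropositionalEquality.Properties as ≡
open import Relation.Nullary.Decidable using (Dec; does; map′; ¬?; _×-dec_; _⊎-dec_; _→-dec_)
open import Relation.Unary using (Pred; Decidable)

------------------------------------------------------------------------
-- Digraphs

record Digraph : Set₁ where
  field
    vertices : Setoid 0ℓ 0ℓ
  open Setoid vertices public using () renaming (Carrier to Vertex; _≈_ to _≈ᵥ_)
  field
    Edge : Vertex → Vertex → Set

record _≅_ (G H : Digraph) : Set where
  private
    module G = Digraph G
    module H = Digraph H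
  field
    bijection : Inverse G.vertices H.vertices
  open Inverse bijection public using (to)
  field
    edges : ∀ u v → G.Edge u v ⇔ H.Edge (to u) (to v)

infix 4 _≅_

------------------------------------------------------------------------
-- Boolean automata networks over S = Fin n

Configuration : ℕ → Set
Configuration n = Vec Bool n

Network : ℕ → Set
Network n = Configuration n → Configuration n

DifferExactlyAt : ∀ {n} → Fin n → Configuration n → Configuration n → Set
DifferExactlyAt i x x′ =
  lookup x i ≢ lookup x′ i × (∀ k → k ≢ i → lookup x k ≡ lookup x′ k)

Influences : ∀ {n} → Network n → Fin n → Fin n → Set
Influences F i j =
  ∃[ x ] ∃[ x′ ] DifferExactlyAt i x x′ × lookup (F x) j ≢ lookup (F x′) j

interactionDigraph : ∀ {n} → Network n → Digraph
interactionDigraph {n} F = record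
  { vertices = ≡.setoid (Fin n)
  ; Edge     = Influences F
  }

anyConfiguration? : ∀ {n} {P : Pred (Configuration n) 0ℓ} → Decidable P → Dec (∃ P)
anyConfiguration? {zero}  P? = map′ ([] ,_) (λ { ([] , p) → p }) (P? [])
anyConfiguration? {suc n} P? =
  map′ (λ { (inj₁ (x , p)) → false ∷ x , p ; (inj₂ (x , p)) → true ∷ x , p })
       (λ { (false ∷ x , p) → inj₁ (x , p) ; (true ∷ x , p) → inj₂ (x , p) })
       (anyConfiguration? (P? ∘ (false ∷_)) ⊎-dec anyConfiguration? (P? ∘ (true ∷_)))

influences? : ∀ {n} (F : Network n) i j → Dec (Influences F i j)
influences? F i j = anyConfiguration? λ x → anyConfiguration? λ x′ →
  (¬? (lookup x i ≟ᵇ lookup x′ i)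
    ×-dec all? (λ k → ¬? (k ≟ i) →-dec (lookup x k ≟ᵇ lookup x′ k)))
  ×-dec ¬? (lookup (F x) j ≟ᵇ lookup (F x′) j)

------------------------------------------------------------------------
-- Update schedules

updateBlock : ∀ {n} → Network n → Subset n → Network n
updateBlock F X x =
  tabulate λ i → if does (i ∈? X) then lookup (F x) i else lookup x i

record BlockSequential (n : ℕ) : Set where
  field
    {size}    : ℕ
    blocks    : Vec (Subset n) size
    nonempty  : ∀ k → Nonempty (lookup blocks k)
    partition : ∀ i → ∃! _≡_ λ k → i ∈ lookup blocks k

  blockOf : Fin n → Fin size
  blockOf i = proj₁ (partition i)

-- The head of the vector of blocks is updated first.
_⟨_⟩ : ∀ {n} → Network n → BlockSequential n → Network n
(F ⟨ Δ ⟩) x = foldl _ (λ y X → updateBlock F X y) x (BlockSequential.blocks Δ)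

parallel : ∀ {n} .{{_ : NonZero n}} → BlockSequential n
parallel {suc n} = record
  { blocks    = ⊤ ∷ []
  ; nonempty  = λ { zero → zero , ∈⊤ }
  ; partition = λ i → zero , ∈⊤ , λ { {zero} _ → refl }
  }

data Label : Set where
  lt ge : Label

HasLabel : ∀ {n} → BlockSequential n → Label → Fin n → Fin n → Set
HasLabel Δ lt u v = BlockSequential.blockOf Δ u < BlockSequential.blockOf Δ v
HasLabel Δ ge u v = BlockSequential.blockOf Δ u ≥ BlockSequential.blockOf Δ v

-- The labelled edges of the update digraph.
UpdateEdge : ∀ {n} → Network n → BlockSequential n → Label → Fin n → Fin n → Set
UpdateEdge F Δ ℓ u v = Digraph.Edge (interactionDigraph F) u v × HasLabel Δ ℓ u v

updateEdge? : ∀ {n} (F : Network n) Δ ℓ u v → Dec (UpdateEdge F Δ ℓ u v)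
updateEdge? F Δ lt u v = influences? F u v ×-dec (_ <? _)
updateEdge? F Δ ge u v = influences? F u v ×-dec (_ ≤? _)

------------------------------------------------------------------------
-- Limit dynamics

-- Cyclic successor.
next : ∀ {k} → Fin k → Fin k
next {suc k} i = suc (toℕ i) mod suc k

record LimitCycle {n} (F : Network n) (k : ℕ) : Set where
  field
    config   : Fin k → Configuration n
    distinct : Injective _≡_ _≡_ config
    step     : ∀ i → F (config i) ≡ config (next i)

OnLimitCycle : ∀ {n} → Network n → Configuration n → Set
OnLimitCycle F x = ∃[ k ] Σ (LimitCycle F k) λ c → ∃[ i ] LimitCycle.config c i ≡ x

dynamics : ∀ {n} → Network n → Digraph
dynamics {n} F = record
  { vertices = ≡.setoid (Configuration n)
  ; Edge     = λ x y → F x ≡ y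
  }

-- Vertices are compared as configurations: how a configuration is shown to be
-- on a limit cycle is irrelevant.
limitDynamics : ∀ {n} → Network n → Digraph
limitDynamics F = record
  { vertices = On.setoid {B = ∃ (OnLimitCycle F)} (Digraph.vertices (dynamics F)) proj₁
  ; Edge     = λ x y → Digraph.Edge (dynamics F) (proj₁ x) (proj₁ y)
  }

------------------------------------------------------------------------
-- Disjunctive double cycles

literal : Sign → Bool → Bool
literal Sign.+ x = x
literal Sign.- x = not x

-- sign i is the sign of the edge from node i to node (next i).
record SignedCycle (n k : ℕ) : Set where
  field
    node      : Fin k → Fin n
    injective : Injective _≡_ _≡_ node
    sign      : Fin k → Sign

  _∈ᶜ : Fin n → Set
  v ∈ᶜ = ∃[ i ] node i ≡ v

  Arc : Fin n → Fin n → Set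
  Arc u v = ∃[ i ] node i ≡ u × node (next i) ≡ v

  cycleSign : Sign
  cycleSign = toSign (parity (count (λ i → sign i ≟ˢ Sign.-) (allFin k)))

record DC (s s′ : Sign) (a b : ℕ) : Set where
  field
    {n}     : ℕ
    network : Network n
    cycleᵃ  : SignedCycle n a
    cycleᵇ  : SignedCycle n b
    central : Fin n

  module A = SignedCycle cycleᵃ
  module B = SignedCycle cycleᵇ

  field
    cover     : ∀ v → v A.∈ᶜ ⊎ v B.∈ᶜ
    intersect : ∀ v → (v A.∈ᶜ × v B.∈ᶜ) ⇔ v ≡ central

    -- Both cycles are listed from the central automaton.
    startᵃ : ∀ i → toℕ i ≡ 0 → A.node i ≡ central
    startᵇ : ∀ i → toℕ i ≡ 0 → B.node i ≡ central

    signᵃ : A.cycleSign ≡ s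
    signᵇ : B.cycleSign ≡ s′

    localᵃ : ∀ x i → A.node (next i) ≢ central →
             lookup (network x) (A.node (next i)) ≡ literal (A.sign i) (lookup x (A.node i))
    localᵇ : ∀ x i → B.node (next i) ≢ central →
             lookup (network x) (B.node (next i)) ≡ literal (B.sign i) (lookup x (B.node i))
    localᶜ : ∀ x i j → A.node (next i) ≡ central → B.node (next j) ≡ central →
             lookup (network x) central ≡
               literal (A.sign i) (lookup x (A.node i)) ∨ literal (B.sign j) (lookup x (B.node j))

    -- The premise only exempts two loops of opposite signs: there the central
    -- clause x ∨ ¬ x is constant, so the interaction digraph has no edge, yet
    -- this network is needed as DC(s,s′,1,1) with s ≢ s′.
    composed : (a ≡ 1 → b ≡ 1 → s ≡ s′) → ∀ u v →
               Digraph.Edge (interactionDigraph network) u v ⇔ (A.Arc u v ⊎ B.Arc u v)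

  n-nonZero : NonZero n
  n-nonZero = nonZeroIndex central

-- The number of edges labelled < on a cycle of the interaction digraph.
#lt : ∀ {n k} → Network n → BlockSequential n → SignedCycle n k → ℕ
#lt {k = k} F Δ C = count (λ i → updateEdge? F Δ lt (node i) (node (next i))) (allFin k)
  where open SignedCycle C

-- Follow only the signal c of the central automaton. An edge labelled < passes a value on
-- within a step, an edge labelled ≥ only in the next one, so each automaton repeats c, up
-- to sign, delayed by the number of ≥ edges on the path from the central automaton, and
--   c(t) = s c(t − (a − A)) ∨ s′ c(t − (b − B)).
-- D′ under the parallel schedule yields the same recurrence. Feeding the signal of one
-- network to the other gives maps that commute with the dynamics and whose composites are
-- iterates of the dynamics; such maps are bijective on the limit cycles.

module Submission where

open import Data.Bool.Base using (Bool; true; false; _∨_; if_then_else_)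
open import Data.Fin.Base using (Fin; zero; suc; toℕ; fromℕ; inject₁; _<_; _≤_)
open import Data.Fin.Induction using (<-weakInduction; <-wellFounded)
open import Data.Fin.Properties
  using (toℕ-injective; toℕ-fromℕ<; toℕ-fromℕ; toℕ-inject₁; toℕ<n; suc-injective; _<?_)
open import Data.Fin.Subset using (Subset; _∈_; _∉_)
open import Data.Fin.Subset.Properties using (_∈?_)
open import Data.Nat.Base using (ℕ; zero; suc; _+_; _*_; _∸_; NonZero; z≤n; s≤s; parity)
import Data.Nat.Base as ℕ
open import Data.Nat.DivMod
  using (_%_; m<n⇒m%n≡m; %-distribˡ-+; m%n%n≡m%n; [m+n]%n≡m%n; n%n≡0)
open import Data.Nat.GeneralisedArithmetic using (fold; fold-+)
open import Data.Nat.Properties as ℕ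
  using (+-comm; +-assoc; +-suc; +-identityʳ; *-suc; *-comm; +-∸-assoc;
         m+n∸m≡n; m+n∸n≡m; m∸n+n≡m; m≤m+n; m≤n+m)
open import Data.Parity.Base using (toSign)
import Data.Parity.Properties as ℙ
open import Data.Product using (∃; _×_; _,_; proj₁; proj₂)
open import Data.Sign.Base as Sign using (Sign)
import Data.Sign.Properties as Sign
open import Data.Sum.Base using (_⊎_; inj₁; inj₂)
open import Data.Vec.Base using (Vec; []; _∷_; lookup; tabulate; foldl; count; allFin)
open import Data.Vec.Properties using (lookup∘tabulate; tabulate∘lookup; tabulate-cong)
open import Function.Base using (_∘_)
open import Function.Bundles using (module Equivalence; mk⇔)
open import Induction.WellFounded using (Acc; acc)
open import Relation.Binary.PropositionalEquality
  using (_≡_; _≢_; refl; sym; trans; cong; cong₂; subst; subst₂; module ≡-Reasoning)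
open import Relation.Nullary.Decidable using (Dec; yes; no; does; dec-true; dec-false)
open import Relation.Nullary.Negation using (¬_; contradiction)
open import Level using (0ℓ)
open import Relation.Unary using (Pred; Decidable)
open import Defs

open ≡-Reasoning

-- Shift equivalence and limit dynamics

module _ {A : Set} (f : A → A) where

  fold-* : ∀ {x} p → fold x f p ≡ x → ∀ m → fold x f (m * p) ≡ x
  fold-* p eq zero = refl
  fold-* {x} p eq (suc m) = begin
    fold x f (p + m * p)        ≡⟨ fold-+ x f p ⟩
    fold (fold x f (m * p)) f p ≡⟨ cong (λ y → fold y f p) (fold-* p eq m) ⟩
    fold x f p                  ≡⟨ eq ⟩
    x                           ∎

  -- The `l` steps and the `l * p` further ones add up to `l` full periods of length `suc p`.
  fold-recover : ∀ {x} p → fold x f (suc p) ≡ x → ∀ l → fold (fold x f l) f (l * p) ≡ x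
  fold-recover {x} p eq l = begin
    fold (fold x f l) f (l * p) ≡⟨ fold-+ x f (l * p) ⟨
    fold x f (l * p + l)        ≡⟨ cong (fold x f) (+-comm (l * p) l) ⟩
    fold x f (l + l * p)        ≡⟨ cong (fold x f) (*-suc l p) ⟨
    fold x f (l * suc p)        ≡⟨ fold-* (suc p) eq l ⟩
    x                           ∎

  -- Iterates are injective on periodic points: running on to a multiple of a common period undoes
  -- the `l` steps for both.
  fold-cancel : ∀ {x y} p q → fold x f (suc p) ≡ x → fold y f (suc q) ≡ y →
                ∀ l → fold x f l ≡ fold y f l → x ≡ y
  fold-cancel {x} {y} p q px qy l eq = begin
    x                           ≡⟨ fold-recover r (fold-* (suc p) px (suc q)) l ⟨
    fold (fold x f l) f (l * r) ≡⟨ cong (λ z → fold z f (l * r)) eq ⟩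
    fold (fold y f l) f (l * r) ≡⟨ fold-recover r qy′ l ⟩
    y                           ∎
    where
    -- Chosen so that `suc r` is definitionally `suc q * suc p`, a common period of `x` and `y`.
    r = p + q * suc p
    qy′ : fold y f (suc r) ≡ y
    qy′ = trans (cong (fold y f) (*-comm (suc q) (suc p))) (fold-* (suc q) qy (suc p))

toℕ-next : ∀ {k} (i : Fin (suc k)) → toℕ (next i) ≡ suc (toℕ i) % suc k
toℕ-next i = toℕ-fromℕ< _

toℕ-fold-next : ∀ {k} (i : Fin (suc k)) m → toℕ (fold i next m) ≡ (m + toℕ i) % suc k
toℕ-fold-next i zero = sym (m<n⇒m%n≡m (toℕ<n i))
toℕ-fold-next {k} i (suc m) = begin
  toℕ (next (fold i next m))       ≡⟨ toℕ-next (fold i next m) ⟩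
  suc (toℕ (fold i next m)) % K    ≡⟨ cong (λ j → suc j % K) (toℕ-fold-next i m) ⟩
  suc (j % K) % K                  ≡⟨ %-distribˡ-+ 1 (j % K) K ⟩
  (1 % K + j % K % K) % K          ≡⟨ cong (λ l → (1 % K + l) % K) (m%n%n≡m%n j K) ⟩
  (1 % K + j % K) % K              ≡⟨ %-distribˡ-+ 1 j K ⟨
  suc j % K                        ∎
  where
  K = suc k
  j = m + toℕ i

fold-next-period : ∀ {k} (i : Fin (suc k)) → fold i next (suc k) ≡ i
fold-next-period {k} i = toℕ-injective (begin
  toℕ (fold i next (suc k)) ≡⟨ toℕ-fold-next i (suc k) ⟩
  (suc k + toℕ i) % suc k   ≡⟨ cong (_% suc k) (+-comm (suc k) (toℕ i)) ⟩
  (toℕ i + suc k) % suc k   ≡⟨ [m+n]%n≡m%n (toℕ i) (suc k) ⟩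
  toℕ i % suc k             ≡⟨ m<n⇒m%n≡m (toℕ<n i) ⟩
  toℕ i                     ∎)

next-inject₁ : ∀ {k} (i : Fin k) → next (inject₁ i) ≡ suc i
next-inject₁ {k} i = toℕ-injective (begin
  toℕ (next (inject₁ i))         ≡⟨ toℕ-next (inject₁ i) ⟩
  suc (toℕ (inject₁ i)) % suc k  ≡⟨ cong (λ j → suc j % suc k) (toℕ-inject₁ i) ⟩
  suc (toℕ i) % suc k            ≡⟨ m<n⇒m%n≡m (s≤s (toℕ<n i)) ⟩
  suc (toℕ i)                    ∎)

next-fromℕ : ∀ k → next (fromℕ k) ≡ zero
next-fromℕ k = toℕ-injective (begin
  toℕ (next (fromℕ k))         ≡⟨ toℕ-next (fromℕ k) ⟩
  suc (toℕ (fromℕ k)) % suc k  ≡⟨ cong (λ j → suc j % suc k) (toℕ-fromℕ k) ⟩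
  suc k % suc k                ≡⟨ n%n≡0 (suc k) ⟩
  0                            ∎)

module _ {n} {F : Network n} where

  config-fold : ∀ {k} (c : LimitCycle F k) i m → let open LimitCycle c in
                fold (config i) F m ≡ config (fold i next m)
  config-fold c i zero    = refl
  config-fold c i (suc m) = trans (cong F (config-fold c i m)) (LimitCycle.step c _)

  config-period : ∀ {k} (c : LimitCycle F (suc k)) i → let open LimitCycle c in
                  fold (config i) F (suc k) ≡ config i
  config-period {k} c i =
    trans (config-fold c i (suc k)) (cong (LimitCycle.config c) (fold-next-period i))

  periodic : ∀ {x} → OnLimitCycle F x → ∃ λ p → fold x F (suc p) ≡ x
  periodic (suc p , c , i , refl) = p , config-period c i

  F-onLimitCycle : ∀ {x} → OnLimitCycle F x → OnLimitCycle F (F x)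
  F-onLimitCycle (k , c , i , refl) = k , c , next i , sym (LimitCycle.step c i)

  fold-onLimitCycle : ∀ {x} m → OnLimitCycle F x → OnLimitCycle F (fold x F m)
  fold-onLimitCycle zero    on = on
  fold-onLimitCycle (suc m) on = F-onLimitCycle (fold-onLimitCycle m on)

-- Shift equivalence in the sense of symbolic dynamics. The two maps may collapse transient
-- configurations, but on periodic ones the iterates of `F` and `G` are invertible, and so are the
-- maps.
record ShiftEquivalence {n m} (F : Network n) (G : Network m) : Set where
  field
    lag     : ℕ
    to      : Configuration n → Configuration m
    from    : Configuration m → Configuration n
    to-F    : ∀ x → to (F x) ≡ G (to x)
    from-G  : ∀ y → from (G y) ≡ F (from y)
    from-to : ∀ x → from (to x) ≡ fold x F lag
    to-from : ∀ y → to (from y) ≡ fold y G lag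

flip-equivalence : ∀ {n m} {F : Network n} {G : Network m} →
                   ShiftEquivalence F G → ShiftEquivalence G F
flip-equivalence E = record
  { lag = lag ; to = from ; from = to ; to-F = from-G ; from-G = to-F
  ; from-to = to-from ; to-from = from-to }
  where open ShiftEquivalence E

module _ {n m} {F : Network n} {G : Network m} (E : ShiftEquivalence F G) where
  open ShiftEquivalence E

  to-injective : ∀ {x y} → OnLimitCycle F x → OnLimitCycle F y → to x ≡ to y → x ≡ y
  to-injective {x} {y} onx ony eq =
    fold-cancel F (proj₁ (periodic onx)) (proj₁ (periodic ony))
                  (proj₂ (periodic onx)) (proj₂ (periodic ony)) lag (begin
      fold x F lag ≡⟨ from-to x ⟨
      from (to x)  ≡⟨ cong from eq ⟩
      from (to y)  ≡⟨ from-to y ⟩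
      fold y F lag ∎)

  -- The image cycle keeps the length `k`, because `to` is injective on limit cycles and so keeps
  -- the configurations distinct.
  to-onLimitCycle : ∀ {x} → OnLimitCycle F x → OnLimitCycle G (to x)
  to-onLimitCycle (k , c , i , refl) = k , image , i , refl
    where
    open LimitCycle c
    image : LimitCycle G k
    image = record
      { config   = to ∘ config
      ; distinct = λ eq → distinct (to-injective (k , c , _ , refl) (k , c , _ , refl) eq)
      ; step     = λ j → trans (sym (to-F (config j))) (cong to (step j))
      }

-- Injectivity of `to` on limit cycles serves twice: it reflects edges, and it turns the right
-- inverse given by `forth-back` into a two-sided one.
limitDynamics-≅ : ∀ {n m} {F : Network n} {G : Network m} →
                  ShiftEquivalence F G → limitDynamics F ≅ limitDynamics G
limitDynamics-≅ {F = F} {G} E = record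
  { bijection = record
    { to        = forth
    ; from      = back
    ; to-cong   = cong to
    ; from-cong = λ {u} {v} eq → to-injective E (proj₂ (back u)) (proj₂ (back v))
        (trans (forth-back u) (trans eq (sym (forth-back v))))
    ; inverse   = (λ {v} {u} eq → trans (cong to eq) (forth-back v))
                , (λ {u} {v} eq → to-injective E (proj₂ (back v)) (proj₂ u)
                     (trans (forth-back v) eq))
    }
  ; edges = λ u v → mk⇔
      (λ eq → trans (sym (to-F (proj₁ u))) (cong to eq))
      (λ eq → to-injective E (F-onLimitCycle (proj₂ u)) (proj₂ v)
                (trans (to-F (proj₁ u)) eq))
  }
  where
  open ShiftEquivalence E

  forth : ∃ (OnLimitCycle F) → ∃ (OnLimitCycle G)
  forth (x , on) = to x , to-onLimitCycle E on

  -- to ∘ from is G iterated lag times; it is undone by running around the cycle.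
  rewind : ∃ (OnLimitCycle G) → ℕ
  rewind (y , on) = lag * proj₁ (periodic on)

  back : ∃ (OnLimitCycle G) → ∃ (OnLimitCycle F)
  back v@(y , on) = from (fold y G (rewind v))
                  , to-onLimitCycle (flip-equivalence E) (fold-onLimitCycle (rewind v) on)

  forth-back : ∀ v → to (proj₁ (back v)) ≡ proj₁ v
  forth-back v@(y , on) = begin
    to (from (fold y G (rewind v)))   ≡⟨ to-from _ ⟩
    fold (fold y G (rewind v)) G lag  ≡⟨ fold-+ y G lag ⟨
    fold y G (lag + rewind v)         ≡⟨ cong (fold y G) (+-comm lag (rewind v)) ⟩
    fold y G (rewind v + lag)         ≡⟨ fold-+ y G (rewind v) ⟩
    fold (fold y G lag) G (rewind v)  ≡⟨ fold-recover G (proj₁ (periodic on)) (proj₂ (periodic on)) lag ⟩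
    y                                 ∎

-- Delay lines

literal-* : ∀ s t x → literal (s Sign.* t) x ≡ literal s (literal t x)
literal-* Sign.+ t      x     = refl
literal-* Sign.- Sign.+ x     = refl
literal-* Sign.- Sign.- true  = refl
literal-* Sign.- Sign.- false = refl

lookup-injective : ∀ {A : Set} {n} {xs ys : Vec A n} →
                   (∀ i → lookup xs i ≡ lookup ys i) → xs ≡ ys
lookup-injective {xs = xs} {ys} eq =
  trans (sym (tabulate∘lookup xs)) (trans (tabulate-cong eq) (tabulate∘lookup ys))

-- With time `suc m + (a + b)` on the left, going back by `a` leaves `suc m + b` and going back by
-- `b` leaves `suc m + a`, so no subtraction occurs. Index 0 is never read.
Recurrence : Sign → Sign → ℕ → ℕ → (ℕ → Bool) → Set
Recurrence s s′ a b c =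
  ∀ m → c (suc m + (a + b)) ≡ literal s (c (suc m + b)) ∨ literal s′ (c (suc m + a))

-- A network all of whose automata repeat, up to sign and after a fixed delay,
-- the signal of one automaton, which itself obeys the recurrence of DC(s,s′,a,b)
-- under the parallel schedule.
record DelayLine {n} (F : Network n) (s s′ : Sign) (a b : ℕ) : Set where
  field
    central       : Fin n
    delay         : Fin n → ℕ
    polarity      : Fin n → Sign
    delay≤        : ∀ v → delay v ℕ.≤ a + b
    delay-central : delay central ≡ 0
    sign-central  : polarity central ≡ Sign.+

  signal : Configuration n → ℕ → Bool
  signal x m = lookup (fold x F m) central

  -- `decode c t` stands for the configuration at time `t + (a + b)`. By `delay≤` this offset covers
  -- every delay, so the truncated subtraction is exact.
  decodeAt : (ℕ → Bool) → ℕ → Fin n → Bool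
  decodeAt c t v = literal (polarity v) (c (t + (a + b ∸ delay v)))

  decode : (ℕ → Bool) → ℕ → Configuration n
  decode c t = tabulate (decodeAt c t)

  field
    -- The first step is excluded: an edge labelled < transmits its signal only
    -- once its head has been updated.
    repeats    : ∀ x m v → lookup (fold x F (suc m + delay v)) v
                             ≡ literal (polarity v) (signal x (suc m))
    recurrence : ∀ x → Recurrence s s′ a b (signal x)
    driven     : ∀ c → Recurrence s s′ a b c → ∀ t → F (decode c t) ≡ decode c (suc t)

  lookup-decode-central : ∀ c t → lookup (decode c t) central ≡ c (t + (a + b))
  lookup-decode-central c t = begin
    lookup (decode c t) central ≡⟨ lookup∘tabulate (decodeAt c t) central ⟩
    decodeAt c t central        ≡⟨ cong₂ (λ σ d → literal σ (c (t + (a + b ∸ d)))) sign-central delay-central ⟩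
    c (t + (a + b))             ∎

  signal-F : ∀ x m → signal (F x) m ≡ signal x (suc m)
  signal-F x m = cong (λ y → lookup y central)
    (trans (sym (fold-+ x F m)) (cong (fold x F) (+-comm m 1)))

module _ {n m} {F : Network n} {G : Network m} {s s′ a b}
         (X : DelayLine F s s′ a b) (Y : DelayLine G s s′ a b) where
  private
    module X = DelayLine X
    module Y = DelayLine Y

  -- Decoding at time 1 makes the time index met in `transfer-transfer` a successor whatever `a + b`
  -- is, as `repeats` demands.
  transfer : Configuration n → Configuration m
  transfer x = Y.decode (X.signal x) 1

  transfer-F : ∀ x → transfer (F x) ≡ G (transfer x)
  transfer-F x = begin
    Y.decode (X.signal (F x)) 1
      ≡⟨ tabulate-cong (λ v →
           cong (literal (Y.polarity v)) (X.signal-F x (suc (a + b ∸ Y.delay v)))) ⟩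
    Y.decode (X.signal x) 2
      ≡⟨ Y.driven (X.signal x) (X.recurrence x) 1 ⟨
    G (Y.decode (X.signal x) 1)
      ∎

  transfer-fold : ∀ x k → transfer (fold x F k) ≡ fold (transfer x) G k
  transfer-fold x zero    = refl
  transfer-fold x (suc k) = trans (transfer-F (fold x F k)) (cong G (transfer-fold x k))

  -- The lead of `suc (a + b)` is the 1 chosen in `transfer` plus the offset built into `decodeAt`.
  signal-transfer : ∀ x k → Y.signal (transfer x) k ≡ X.signal x (suc (a + b) + k)
  signal-transfer x k = begin
    Y.signal (transfer x) k                                ≡⟨ cong (λ y → lookup y Y.central) (transfer-fold x k) ⟨
    lookup (transfer (fold x F k)) Y.central               ≡⟨ Y.lookup-decode-central (X.signal (fold x F k)) 1 ⟩
    X.signal (fold x F k) (suc (a + b))                    ≡⟨ cong (λ y → lookup y X.central) (fold-+ x F (suc (a + b))) ⟨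
    X.signal x (suc (a + b) + k)                           ∎

module _ {n m} {F : Network n} {G : Network m} {s s′ a b}
         (X : DelayLine F s s′ a b) (Y : DelayLine G s s′ a b) where
  private
    module X = DelayLine X
    module Y = DelayLine Y
    N = a + b

  transfer-transfer : ∀ x → transfer Y X (transfer X Y x) ≡ fold x F (suc N + suc N)
  transfer-transfer x = lookup-injective λ v →
    let r = N ∸ X.delay v in begin
    lookup (X.decode (Y.signal (transfer X Y x)) 1) v
      ≡⟨ lookup∘tabulate (X.decodeAt (Y.signal (transfer X Y x)) 1) v ⟩
    literal (X.polarity v) (Y.signal (transfer X Y x) (suc r))
      ≡⟨ cong (literal (X.polarity v)) (signal-transfer X Y x (suc r)) ⟩
    literal (X.polarity v) (X.signal x (suc N + suc r))
      -- The delay restored here cancels against `r`, so the final time is the same for every `v`.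
      ≡⟨ X.repeats x (N + suc r) v ⟨
    lookup (fold x F (suc N + suc r + X.delay v)) v
      ≡⟨ cong (λ k → lookup (fold x F k) v)
           (trans (+-assoc (suc N) (suc r) (X.delay v))
                  (cong (λ k → suc N + suc k) (m∸n+n≡m (X.delay≤ v)))) ⟩
    lookup (fold x F (suc N + suc N)) v
      ∎

delayLines-equivalent : ∀ {n m} {F : Network n} {G : Network m} {s s′ a b} →
  DelayLine F s s′ a b → DelayLine G s s′ a b → ShiftEquivalence F G
delayLines-equivalent {a = a} {b} X Y = record
  { lag     = suc (a + b) + suc (a + b)
  ; to      = transfer X Y
  ; from    = transfer Y X
  ; to-F    = transfer-F X Y
  ; from-G  = transfer-F Y X
  ; from-to = transfer-transfer X Y
  ; to-from = transfer-transfer Y X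
  }

-- Block-sequential updates

module _ {n} (F : Network n) where

  -- The fold behind `_⟨_⟩`, freed from the partition so that induction on the blocks is possible.
  run : ∀ {m} → Vec (Subset n) m → Network n
  run Xs x = foldl (λ _ → Configuration n) (λ y X → updateBlock F X y) x Xs

  updateBlock-∈ : ∀ {X v} x → v ∈ X → lookup (updateBlock F X x) v ≡ lookup (F x) v
  updateBlock-∈ {X} {v} x v∈X
    rewrite lookup∘tabulate (λ i → if does (i ∈? X) then lookup (F x) i else lookup x i) v
          | dec-true (v ∈? X) v∈X = refl

  updateBlock-∉ : ∀ {X v} x → v ∉ X → lookup (updateBlock F X x) v ≡ lookup x v
  updateBlock-∉ {X} {v} x v∉X
    rewrite lookup∘tabulate (λ i → if does (i ∈? X) then lookup (F x) i else lookup x i) v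
          | dec-false (v ∈? X) v∉X = refl

  run-∉ : ∀ {m} (Xs : Vec (Subset n) m) x {v} → (∀ l → v ∉ lookup Xs l) →
          lookup (run Xs x) v ≡ lookup x v
  run-∉ []       x v∉ = refl
  run-∉ (X ∷ Xs) x v∉ =
    trans (run-∉ Xs (updateBlock F X x) (v∉ ∘ suc)) (updateBlock-∉ x (v∉ zero))

  -- The witness is the configuration in which block k is updated.
  run-∈ : ∀ {m} (Xs : Vec (Subset n) m) x {v} k → v ∈ lookup Xs k →
          (∀ {l} → v ∈ lookup Xs l → k ≡ l) →
          ∃ λ z → lookup (run Xs x) v ≡ lookup (F z) v
                × (∀ u → (∀ l → k ≤ l → u ∉ lookup Xs l) → lookup z u ≡ lookup (run Xs x) u)
                × (∀ u → (∀ l → l < k → u ∉ lookup Xs l) → lookup z u ≡ lookup x u)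
  run-∈ (X ∷ Xs) x zero v∈ unique =
      x
    , trans (run-∉ Xs (updateBlock F X x) (λ l v∈l → contradiction (unique {suc l} v∈l) λ ()))
            (updateBlock-∈ x v∈)
    -- Here `k` is `zero`, so the premise keeps `u` out of every block and the whole run leaves it
    -- unchanged.
    , (λ u u∉ → sym (run-∉ (X ∷ Xs) x (λ l → u∉ l z≤n)))
    , (λ u _ → refl)
  run-∈ (X ∷ Xs) x (suc k) v∈ unique
    with run-∈ Xs (updateBlock F X x) k v∈ (λ v∈l → suc-injective (unique v∈l))
  ... | z , eq , before , after =
      z
    , eq
    , (λ u u∉ → before u (λ l k≤l → u∉ (suc l) (s≤s k≤l)))
    , (λ u u∉ → trans (after u (λ l l<k → u∉ (suc l) (s≤s l<k))) (updateBlock-∉ x (u∉ zero (s≤s z≤n))))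

module _ {n} (F : Network n) (Δ : BlockSequential n) where
  open BlockSequential Δ

  -- z agrees with the configuration in which the block of v is updated.
  Interleaved : Configuration n → Fin n → Configuration n → Set
  Interleaved x v z =
      (∀ u → blockOf u < blockOf v → lookup z u ≡ lookup ((F ⟨ Δ ⟩) x) u)
    × (∀ u → blockOf v ≤ blockOf u → lookup z u ≡ lookup x u)

  -- Each automaton lies in a single block: one in an earlier block than `v` already has its final
  -- value when `v` is updated, and one in the same or a later block still has its old value.
  asynchronous : ∀ x v → ∃ λ z → Interleaved x v z × lookup ((F ⟨ Δ ⟩) x) v ≡ lookup (F z) v
  asynchronous x v with partition v
  ... | k , v∈ , unique with run-∈ F blocks x k v∈ unique
  ...   | z , step , before , after =
    z , ((λ u u<v → before u λ l k≤l u∈l →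
             ℕ.<⇒≱ u<v (ℕ.≤-trans k≤l (ℕ.≤-reflexive (cong toℕ (sym (proj₂ (proj₂ (partition u)) u∈l))))))
       , (λ u v≤u → after u λ l l<k u∈l →
             ℕ.<⇒≱ l<k (ℕ.≤-trans v≤u (ℕ.≤-reflexive (cong toℕ (proj₂ (proj₂ (partition u)) u∈l))))))
      , step

-- Partial sums

prefix : ∀ {k} → (Fin k → ℕ) → Fin (suc k) → ℕ
prefix w zero = 0
prefix {suc k} w (suc i) = w zero + prefix (w ∘ suc) i

-- `prefix` peels off the first weight, whereas induction along a cycle appends the last one.
prefix-suc : ∀ {k} (w : Fin k → ℕ) i → prefix w (suc i) ≡ prefix w (inject₁ i) + w i
prefix-suc w zero    = +-comm (w zero) 0
prefix-suc w (suc i) = trans (cong (w zero +_) (prefix-suc (w ∘ suc) i))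
                             (sym (+-assoc (w zero) (prefix (w ∘ suc) (inject₁ i)) (w (suc i))))

prefix≤total : ∀ {k} (w : Fin k → ℕ) i → prefix w i ℕ.≤ prefix w (fromℕ k)
prefix≤total w zero = z≤n
prefix≤total {suc k} w (suc i) = ℕ.+-monoʳ-≤ (w zero) (prefix≤total (w ∘ suc) i)

module _ {A : Set} {P : Pred A 0ℓ} (P? : Decidable P) where

  total-count : ∀ {k} (f : Fin k → A) →
                prefix (λ i → if does (P? (f i)) then 1 else 0) (fromℕ k) ≡ count P? (tabulate f)
  total-count {zero}  f = refl
  total-count {suc k} f with does (P? (f zero))
  ... | true  = cong suc (total-count (f ∘ suc))
  ... | false = total-count (f ∘ suc)

  total+count : ∀ {k} (f : Fin k → A) →
                prefix (λ i → if does (P? (f i)) then 0 else 1) (fromℕ k) + count P? (tabulate f) ≡ k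
  total+count {zero}  f = refl
  total+count {suc k} f with does (P? (f zero))
  ... | true  = trans (+-suc _ _) (cong suc (total+count (f ∘ suc)))
  ... | false = cong suc (total+count (f ∘ suc))

  total-cocount : ∀ {k} (f : Fin k → A) →
                  prefix (λ i → if does (P? (f i)) then 0 else 1) (fromℕ k) ≡ k ∸ count P? (tabulate f)
  total-cocount f = trans (sym (m+n∸n≡m _ (count P? (tabulate f))))
                          (cong (_∸ count P? (tabulate f)) (total+count f))

parity-sign : ℕ → Sign
parity-sign n = toSign (parity n)

parity-sign-+ : ∀ m n → parity-sign (m + n) ≡ parity-sign m Sign.* parity-sign n
parity-sign-+ m n = trans (cong toSign (ℙ.+-homo-+ m n)) (ℙ.+-homo-* (parity m) (parity n))

-- Signals along a cycle

-- `#lt` counts an edge only if it belongs to the interaction digraph. The hypothesis `influences`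
-- makes the order of the blocks alone decide.
module CycleSignals {n} (F : Network n) (Δ : BlockSequential n) {k} (C : SignedCycle n (suc k))
  (influences : ∀ i → HasLabel Δ lt (SignedCycle.node C i) (SignedCycle.node C (next i)) →
                Influences F (SignedCycle.node C i) (SignedCycle.node C (next i)))
  where
  open SignedCycle C
  open BlockSequential Δ

  lt? : ∀ i → Dec (UpdateEdge F Δ lt (node i) (node (next i)))
  lt? i = updateEdge? F Δ lt (node i) (node (next i))

  wait : Fin (suc k) → ℕ
  wait i = if does (lt? i) then 0 else 1

  negation : Fin (suc k) → ℕ
  negation i = if does (sign i Sign.≟ Sign.-) then 1 else 0

  delayAt : Fin (suc (suc k)) → ℕ
  delayAt = prefix wait

  polarityAt : Fin (suc (suc k)) → Sign
  polarityAt i = parity-sign (prefix negation i)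

  -- The origin of the reduced size: a turn around the cycle costs one step per edge, except for the
  -- edges labelled `<`.
  delay-total : delayAt (fromℕ (suc k)) ≡ suc k ∸ #lt F Δ C
  delay-total = total-cocount lt? (λ i → i)

  polarity-total : polarityAt (fromℕ (suc k)) ≡ cycleSign
  polarity-total = cong parity-sign (total-count (λ i → sign i Sign.≟ Sign.-) (λ i → i))

  wait-cases : ∀ i → (blockOf (node i) < blockOf (node (next i)) × wait i ≡ 0)
                   ⊎ (blockOf (node (next i)) ≤ blockOf (node i) × wait i ≡ 1)
  wait-cases i with blockOf (node i) <? blockOf (node (next i))
  ... | yes u<v = inj₁ (u<v , cong (if_then 0 else 1) (dec-true (lt? i) (influences i u<v , u<v)))
  ... | no u≮v  = inj₂ (ℕ.≮⇒≥ u≮v , cong (if_then 0 else 1) (dec-false (lt? i) (u≮v ∘ proj₂)))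

  parity-negation : ∀ i → parity-sign (negation i) ≡ sign i
  parity-negation i with sign i
  ... | Sign.+ = refl
  ... | Sign.- = refl

  polarityAt-suc : ∀ i → polarityAt (suc i) ≡ sign i Sign.* polarityAt (inject₁ i)
  polarityAt-suc i = begin
    parity-sign (prefix negation (suc i))                       ≡⟨ cong parity-sign (prefix-suc negation i) ⟩
    parity-sign (prefix negation (inject₁ i) + negation i)      ≡⟨ parity-sign-+ (prefix negation (inject₁ i)) (negation i) ⟩
    polarityAt (inject₁ i) Sign.* parity-sign (negation i)      ≡⟨ cong (polarityAt (inject₁ i) Sign.*_) (parity-negation i) ⟩
    polarityAt (inject₁ i) Sign.* sign i                        ≡⟨ Sign.*-comm (polarityAt (inject₁ i)) (sign i) ⟩
    sign i Sign.* polarityAt (inject₁ i)                        ∎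

  -- delayAt (suc i) and polarityAt (suc i) also make sense for the edge i that closes
  -- the cycle, where they are the delay and sign of the cycle rather than of a node.
  module Edges (delay : Fin n → ℕ) (polarity : Fin n → Sign)
    (delay-node    : ∀ i → delay (node i) ≡ delayAt (inject₁ i))
    (polarity-node : ∀ i → polarity (node i) ≡ polarityAt (inject₁ i))
    where

    delayAt-suc : ∀ i → delayAt (suc i) ≡ delay (node i) + wait i
    delayAt-suc i = trans (prefix-suc wait i) (cong (_+ wait i) (sym (delay-node i)))

    literal-edge : ∀ i {x y} → x ≡ literal (polarity (node i)) y →
                   literal (sign i) x ≡ literal (polarityAt (suc i)) y
    literal-edge i {x} {y} eq = begin
      literal (sign i) x
        ≡⟨ cong (literal (sign i)) eq ⟩
      literal (sign i) (literal (polarity (node i)) y)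
        ≡⟨ literal-* (sign i) (polarity (node i)) y ⟨
      literal (sign i Sign.* polarity (node i)) y
        ≡⟨ cong (λ σ → literal (sign i Sign.* σ) y) (polarity-node i) ⟩
      literal (sign i Sign.* polarityAt (inject₁ i)) y
        ≡⟨ cong (λ σ → literal σ y) (polarityAt-suc i) ⟨
      literal (polarityAt (suc i)) y
        ∎

    -- An edge labelled `<` shows in `z` the value at time `suc t` and adds no delay; any other edge
    -- shows the value at time `t` and adds a delay of one. Both times equal
    -- `suc m + delay (node i)`.
    edge-repeats : ∀ x m y i z {t} → t ≡ m + delayAt (suc i) →
      Interleaved F Δ (fold x (F ⟨ Δ ⟩) t) (node (next i)) z →
      lookup (fold x (F ⟨ Δ ⟩) (suc m + delay (node i))) (node i) ≡ literal (polarity (node i)) y →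
      literal (sign i) (lookup z (node i)) ≡ literal (polarityAt (suc i)) y
    edge-repeats x m y i z {t} refl (before , after) eq = literal-edge i (trans z≡ eq)
      where
      t≡ : ∀ {w} → wait i ≡ w → t ≡ m + (delay (node i) + w)
      t≡ w≡ = cong (m +_) (trans (delayAt-suc i) (cong (delay (node i) +_) w≡))
      z≡ : lookup z (node i) ≡ lookup (fold x (F ⟨ Δ ⟩) (suc m + delay (node i))) (node i)
      z≡ with wait-cases i
      ... | inj₁ (u<v , w≡) = trans (before (node i) u<v)
              (cong (λ s → lookup (fold x (F ⟨ Δ ⟩) (suc s)) (node i))
                    (trans (t≡ w≡) (cong (m +_) (+-identityʳ _))))
      ... | inj₂ (v≤u , w≡) = trans (after (node i) v≤u)
              (cong (λ s → lookup (fold x (F ⟨ Δ ⟩) s) (node i))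
                    (trans (t≡ w≡) (trans (cong (m +_) (+-comm _ 1)) (+-suc m _))))

    -- An edge labelled `<` reads time `suc t` at an unchanged delay. Any other edge reads time `t`,
    -- and the step gained is offset by the delay growing by one; `delayAt (suc i) ≤ N` makes the
    -- subtraction exact there.
    edge-driven : ∀ (c : ℕ → Bool) t {N} i {y} z → delayAt (suc i) ℕ.≤ N →
      Interleaved F Δ y (node (next i)) z →
      lookup y (node i) ≡ literal (polarity (node i)) (c (t + (N ∸ delay (node i)))) →
      (blockOf (node i) < blockOf (node (next i)) →
        lookup ((F ⟨ Δ ⟩) y) (node i) ≡ literal (polarity (node i)) (c (suc t + (N ∸ delay (node i))))) →
      literal (sign i) (lookup z (node i)) ≡ literal (polarityAt (suc i)) (c (suc t + (N ∸ delayAt (suc i))))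
    edge-driven c t {N} i {y} z d≤N (before , after) old new = literal-edge i z≡
      where
      d = delay (node i)
      d≡ : ∀ {w} → wait i ≡ w → delayAt (suc i) ≡ d + w
      d≡ w≡ = trans (delayAt-suc i) (cong (d +_) w≡)
      z≡ : lookup z (node i) ≡ literal (polarity (node i)) (c (suc t + (N ∸ delayAt (suc i))))
      z≡ with wait-cases i
      ... | inj₁ (u<v , w≡) = trans (before (node i) u<v) (trans (new u<v)
              (cong (λ e → literal (polarity (node i)) (c (suc t + (N ∸ e))))
                    (sym (trans (d≡ w≡) (+-identityʳ d)))))
      ... | inj₂ (v≤u , w≡) = trans (after (node i) v≤u) (trans old
              (cong (λ s → literal (polarity (node i)) (c s)) shift))
        where
        d≡suc : delayAt (suc i) ≡ suc d
        d≡suc = trans (d≡ w≡) (+-comm d 1)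
        shift : t + (N ∸ d) ≡ suc t + (N ∸ delayAt (suc i))
        shift = begin
          t + (N ∸ d)                   ≡⟨ cong (t +_) (+-∸-assoc 1 (subst (ℕ._≤ N) d≡suc d≤N)) ⟩
          t + suc (N ∸ suc d)           ≡⟨ +-suc t _ ⟩
          suc t + (N ∸ suc d)           ≡⟨ cong (λ e → suc t + (N ∸ e)) d≡suc ⟨
          suc t + (N ∸ delayAt (suc i)) ∎

    -- Restricted to the edges `inject₁ j`: the closing edge enters the central automaton, which
    -- obeys the clause instead.
    module _ (local : ∀ x j → lookup (F x) (node (next (inject₁ j)))
                                ≡ literal (sign (inject₁ j)) (lookup x (node (inject₁ j)))) where

      nodes-repeat : ∀ x m {y} →
        lookup (fold x (F ⟨ Δ ⟩) (suc m + delay (node zero))) (node zero) ≡ literal (polarity (node zero)) y →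
        ∀ i → lookup (fold x (F ⟨ Δ ⟩) (suc m + delay (node i))) (node i) ≡ literal (polarity (node i)) y
      nodes-repeat x m {y} first = <-weakInduction _ first λ j ih →
        let i = inject₁ j
            -- The update from `t` to `suc t` is the one at which the head of edge `i` takes on the
            -- repeated value.
            t = m + delayAt (suc i)
            (z , mixed , step) = asynchronous F Δ (fold x (F ⟨ Δ ⟩) t) (node (next i)) in begin
        lookup (fold x (F ⟨ Δ ⟩) (suc m + delay (node (suc j)))) (node (suc j))
          ≡⟨ cong₂ (λ d v → lookup (fold x (F ⟨ Δ ⟩) (suc m + d)) (node v))
               (delay-node (suc j)) (sym (next-inject₁ j)) ⟩
        lookup (fold x (F ⟨ Δ ⟩) (suc t)) (node (next i))
          ≡⟨ trans step (local z j) ⟩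
        literal (sign i) (lookup z (node i))
          ≡⟨ edge-repeats x m y i z refl mixed ih ⟩
        literal (polarityAt (suc i)) y
          ≡⟨ cong (λ σ → literal σ y) (polarity-node (suc j)) ⟨
        literal (polarity (node (suc j))) y
          ∎

      -- A single edge, with no induction along the cycle: the predecessor is read from `y` or from
      -- an earlier block, and `new` is the hypothesis of an induction on blocks.
      node-driven : ∀ (c : ℕ → Bool) t {N} j {y} → delayAt (suc (inject₁ j)) ℕ.≤ N →
        (∀ v → lookup y v ≡ literal (polarity v) (c (t + (N ∸ delay v)))) →
        (∀ v → blockOf v < blockOf (node (suc j)) →
          lookup ((F ⟨ Δ ⟩) y) v ≡ literal (polarity v) (c (suc t + (N ∸ delay v)))) →
        lookup ((F ⟨ Δ ⟩) y) (node (suc j))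
          ≡ literal (polarity (node (suc j))) (c (suc t + (N ∸ delay (node (suc j)))))
      node-driven c t {N} j {y} d≤N old new =
        let i = inject₁ j
            (z , mixed , step) = asynchronous F Δ y (node (next i)) in begin
        lookup ((F ⟨ Δ ⟩) y) (node (suc j))
          ≡⟨ cong (λ v → lookup ((F ⟨ Δ ⟩) y) (node v)) (next-inject₁ j) ⟨
        lookup ((F ⟨ Δ ⟩) y) (node (next i))
          ≡⟨ trans step (local z j) ⟩
        literal (sign i) (lookup z (node i))
          ≡⟨ edge-driven c t i z d≤N mixed (old (node i))
               (λ u<v → new (node i) (subst (λ v → blockOf (node i) < blockOf (node v)) (next-inject₁ j) u<v)) ⟩
        literal (polarityAt (suc i)) (c (suc t + (N ∸ delayAt (suc i))))
          ≡⟨ cong₂ (λ σ d → literal σ (c (suc t + (N ∸ d)))) (polarity-node (suc j)) (delay-node (suc j)) ⟨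
        literal (polarity (node (suc j))) (c (suc t + (N ∸ delay (node (suc j)))))
          ∎

-- Double cycles

module DoubleCycle {s s′ k l} (D : DC s s′ (suc k) (suc l)) (Δ : BlockSequential (DC.n D)) where
  open DC D
  open BlockSequential Δ

  F : Network n
  F = network

  node-zeroᵃ : A.node zero ≡ central
  node-zeroᵃ = startᵃ zero refl

  node-zeroᵇ : B.node zero ≡ central
  node-zeroᵇ = startᵇ zero refl

  node-suc≢centralᵃ : ∀ j → A.node (next (inject₁ j)) ≢ central
  node-suc≢centralᵃ j eq
    with () ← trans (sym (next-inject₁ j)) (A.injective (trans eq (sym node-zeroᵃ)))

  node-suc≢centralᵇ : ∀ j → B.node (next (inject₁ j)) ≢ central
  node-suc≢centralᵇ j eq
    with () ← trans (sym (next-inject₁ j)) (B.injective (trans eq (sym node-zeroᵇ)))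

  -- The ends of an edge labelled < differ, so its cycle is not a loop and composed applies.
  influencesᵃ : ∀ i → blockOf (A.node i) < blockOf (A.node (next i)) →
                Influences F (A.node i) (A.node (next i))
  influencesᵃ i u<v = Equivalence.from (composed (λ a≡1 _ → not-loop a≡1 i u<v) _ _) (inj₁ (i , refl , refl))
    where
    not-loop : ∀ {X : Set} → suc k ≡ 1 → ∀ i → blockOf (A.node i) < blockOf (A.node (next i)) → X
    not-loop refl zero u<u = contradiction u<u (ℕ.<-irrefl refl)

  influencesᵇ : ∀ i → blockOf (B.node i) < blockOf (B.node (next i)) →
                Influences F (B.node i) (B.node (next i))
  influencesᵇ i u<v = Equivalence.from (composed (λ _ b≡1 → not-loop b≡1 i u<v) _ _) (inj₂ (i , refl , refl))
    where
    not-loop : ∀ {X : Set} → suc l ≡ 1 → ∀ i → blockOf (B.node i) < blockOf (B.node (next i)) → X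
    not-loop refl zero u<u = contradiction u<u (ℕ.<-irrefl refl)

  module SA = CycleSignals F Δ cycleᵃ influencesᵃ
  module SB = CycleSignals F Δ cycleᵇ influencesᵇ

  module _ {X : Set} (f : Fin (suc k) → X) (g : Fin (suc l) → X) where

    merge : Fin n → X
    merge v with cover v
    ... | inj₁ (i , _) = f i
    ... | inj₂ (j , _) = g j

    module _ (agree : f zero ≡ g zero) where

      -- The cycles meet only in the central automaton, which has index `zero` on both. Agreement
      -- there makes `merge` independent of the side that `cover` picks.
      agree-meet : ∀ {i j} → A.node i ≡ B.node j → f i ≡ g j
      agree-meet {i} {j} eq = begin
        f i    ≡⟨ cong f (A.injective (trans c (sym node-zeroᵃ))) ⟩
        f zero ≡⟨ agree ⟩
        g zero ≡⟨ cong g (B.injective (trans (sym eq) (trans c (sym node-zeroᵇ)))) ⟨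
        g j    ∎
        where
        c : A.node i ≡ central
        c = Equivalence.to (intersect (A.node i)) ((i , refl) , (j , sym eq))

      merge-nodeᵃ : ∀ i → merge (A.node i) ≡ f i
      merge-nodeᵃ i with cover (A.node i)
      ... | inj₁ (i′ , eq) = cong f (A.injective eq)
      ... | inj₂ (j , eq)  = sym (agree-meet (sym eq))

      merge-nodeᵇ : ∀ j → merge (B.node j) ≡ g j
      merge-nodeᵇ j with cover (B.node j)
      ... | inj₁ (i , eq)  = agree-meet eq
      ... | inj₂ (j′ , eq) = cong g (B.injective eq)

  delay : Fin n → ℕ
  delay = merge (SA.delayAt ∘ inject₁) (SB.delayAt ∘ inject₁)

  polarity : Fin n → Sign
  polarity = merge (SA.polarityAt ∘ inject₁) (SB.polarityAt ∘ inject₁)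

  -- Both cycles start with delay 0 and sign `+`, hence the proofs of agreement by `refl`.
  module EA = SA.Edges delay polarity
    (merge-nodeᵃ _ (SB.delayAt ∘ inject₁) refl) (merge-nodeᵃ _ (SB.polarityAt ∘ inject₁) refl)
  module EB = SB.Edges delay polarity
    (merge-nodeᵇ (SA.delayAt ∘ inject₁) _ refl) (merge-nodeᵇ (SA.polarityAt ∘ inject₁) _ refl)

  delay-central : delay central ≡ 0
  delay-central = trans (cong delay (sym node-zeroᵃ))
                        (merge-nodeᵃ (SA.delayAt ∘ inject₁) (SB.delayAt ∘ inject₁) refl zero)

  sign-central : polarity central ≡ Sign.+
  sign-central = trans (cong polarity (sym node-zeroᵃ))
                       (merge-nodeᵃ (SA.polarityAt ∘ inject₁) (SB.polarityAt ∘ inject₁) refl zero)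

  -- The reduced sizes in the form in which they arise, as total waits; `delay-total` converts them
  -- in `doubleCycle-delayLine`.
  a′ b′ : ℕ
  a′ = SA.delayAt (fromℕ (suc k))
  b′ = SB.delayAt (fromℕ (suc l))

  delayᵃ≤ : ∀ i → SA.delayAt i ℕ.≤ a′ + b′
  delayᵃ≤ i = ℕ.≤-trans (prefix≤total SA.wait i) (m≤m+n a′ b′)

  delayᵇ≤ : ∀ i → SB.delayAt i ℕ.≤ a′ + b′
  delayᵇ≤ i = ℕ.≤-trans (prefix≤total SB.wait i) (m≤n+m b′ a′)

  delay≤ : ∀ v → delay v ℕ.≤ a′ + b′
  delay≤ v with cover v
  ... | inj₁ (i , _) = delayᵃ≤ (inject₁ i)
  ... | inj₂ (j , _) = delayᵇ≤ (inject₁ j)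

  closeᵃ : A.node (next (fromℕ k)) ≡ central
  closeᵃ = trans (cong A.node (next-fromℕ k)) node-zeroᵃ

  closeᵇ : B.node (next (fromℕ l)) ≡ central
  closeᵇ = trans (cong B.node (next-fromℕ l)) node-zeroᵇ

  signal : Configuration n → ℕ → Bool
  signal x m = lookup (fold x (F ⟨ Δ ⟩) m) central

  cover-elim : (P : Fin n → Set) → (∀ i → P (A.node i)) → (∀ j → P (B.node j)) → ∀ v → P v
  cover-elim P pa pb v with cover v
  ... | inj₁ (i , refl) = pa i
  ... | inj₂ (j , refl) = pb j

  Repeats : Configuration n → ℕ → Fin n → Set
  Repeats x m v = lookup (fold x (F ⟨ Δ ⟩) (suc m + delay v)) v
                    ≡ literal (polarity v) (signal x (suc m))

  repeats-central : ∀ x m → Repeats x m central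
  repeats-central x m = begin
    lookup (fold x (F ⟨ Δ ⟩) (suc m + delay central)) central ≡⟨ cong (λ d → signal x (suc m + d)) delay-central ⟩
    signal x (suc m + 0)                                      ≡⟨ cong (signal x) (+-identityʳ (suc m)) ⟩
    signal x (suc m)                                          ≡⟨ cong (λ σ → literal σ (signal x (suc m))) sign-central ⟨
    literal (polarity central) (signal x (suc m))             ∎

  localᵃ-suc : ∀ x j → lookup (F x) (A.node (next (inject₁ j)))
                         ≡ literal (A.sign (inject₁ j)) (lookup x (A.node (inject₁ j)))
  localᵃ-suc x j = localᵃ x (inject₁ j) (node-suc≢centralᵃ j)

  localᵇ-suc : ∀ x j → lookup (F x) (B.node (next (inject₁ j)))
                         ≡ literal (B.sign (inject₁ j)) (lookup x (B.node (inject₁ j)))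
  localᵇ-suc x j = localᵇ x (inject₁ j) (node-suc≢centralᵇ j)

  repeatsᵃ : ∀ x m i → Repeats x m (A.node i)
  repeatsᵃ x m = EA.nodes-repeat localᵃ-suc x m
    (subst (Repeats x m) (sym node-zeroᵃ) (repeats-central x m))

  repeatsᵇ : ∀ x m j → Repeats x m (B.node j)
  repeatsᵇ x m = EB.nodes-repeat localᵇ-suc x m
    (subst (Repeats x m) (sym node-zeroᵇ) (repeats-central x m))

  σᵃ σᵇ : Sign
  σᵃ = SA.polarityAt (fromℕ (suc k))
  σᵇ = SB.polarityAt (fromℕ (suc l))

  recurrence : ∀ x → Recurrence σᵃ σᵇ a′ b′ (signal x)
  recurrence x m =
    let t = m + (a′ + b′)
        (z , mixed , step) = asynchronous F Δ (fold x (F ⟨ Δ ⟩) t) central in begin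
    signal x (suc t)
      ≡⟨ trans step (localᶜ z (fromℕ k) (fromℕ l) closeᵃ closeᵇ) ⟩
    literal (A.sign (fromℕ k)) (lookup z (A.node (fromℕ k))) ∨
    literal (B.sign (fromℕ l)) (lookup z (B.node (fromℕ l)))
      ≡⟨ cong₂ _∨_
           -- A turn around this cycle takes `a′` steps, so what returns at `t` left the central
           -- automaton `a′` earlier, which leaves `m + b′`; symmetrically `m + a′` for the other
           -- cycle.
           (EA.edge-repeats x (m + b′) _ (fromℕ k) z
              (trans (cong (m +_) (+-comm a′ b′)) (sym (+-assoc m b′ a′)))
              (subst (λ v → Interleaved F Δ (fold x (F ⟨ Δ ⟩) t) v z) (sym closeᵃ) mixed)
              (repeatsᵃ x (m + b′) (fromℕ k)))
           (EB.edge-repeats x (m + a′) _ (fromℕ l) z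
              (sym (+-assoc m a′ b′))
              (subst (λ v → Interleaved F Δ (fold x (F ⟨ Δ ⟩) t) v z) (sym closeᵇ) mixed)
              (repeatsᵇ x (m + a′) (fromℕ l))) ⟩
    literal σᵃ (signal x (suc m + b′)) ∨ literal σᵇ (signal x (suc m + a′))
      ∎

  module _ (c : ℕ → Bool) (rec : Recurrence σᵃ σᵇ a′ b′ c) (t : ℕ) where

    value : ℕ → Fin n → Bool
    value t v = literal (polarity v) (c (t + (a′ + b′ ∸ delay v)))

    y : Configuration n
    y = tabulate (value t)

    Driven : Fin n → Set
    Driven v = lookup ((F ⟨ Δ ⟩) y) v ≡ value (suc t) v

    y-value : ∀ v → lookup y v ≡ value t v
    y-value = lookup∘tabulate (value t)

    -- The closing edges carry the total delays `a′` and `b′`, so the two literals read `c` at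
    -- exactly the arguments on the right of `rec t`.
    driven-central : (∀ u → blockOf u < blockOf central → Driven u) → Driven central
    driven-central new =
      let (z , mixed , step) = asynchronous F Δ y central in begin
      lookup ((F ⟨ Δ ⟩) y) central
        ≡⟨ trans step (localᶜ z (fromℕ k) (fromℕ l) closeᵃ closeᵇ) ⟩
      literal (A.sign (fromℕ k)) (lookup z (A.node (fromℕ k))) ∨
      literal (B.sign (fromℕ l)) (lookup z (B.node (fromℕ l)))
        ≡⟨ cong₂ _∨_
             (EA.edge-driven c t (fromℕ k) z (delayᵃ≤ (fromℕ (suc k)))
                (subst (λ v → Interleaved F Δ y v z) (sym closeᵃ) mixed)
                (y-value (A.node (fromℕ k)))
                (λ u<v → new (A.node (fromℕ k))
                  (subst (λ v → blockOf (A.node (fromℕ k)) < blockOf v) closeᵃ u<v)))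
             (EB.edge-driven c t (fromℕ l) z (delayᵇ≤ (fromℕ (suc l)))
                (subst (λ v → Interleaved F Δ y v z) (sym closeᵇ) mixed)
                (y-value (B.node (fromℕ l)))
                (λ u<v → new (B.node (fromℕ l))
                  (subst (λ v → blockOf (B.node (fromℕ l)) < blockOf v) closeᵇ u<v))) ⟩
      literal σᵃ (c (suc t + (a′ + b′ ∸ a′))) ∨ literal σᵇ (c (suc t + (a′ + b′ ∸ b′)))
        ≡⟨ cong₂ (λ d e → literal σᵃ (c (suc t + d)) ∨ literal σᵇ (c (suc t + e)))
             (m+n∸m≡n a′ b′) (m+n∸n≡m a′ b′) ⟩
      literal σᵃ (c (suc t + b′)) ∨ literal σᵇ (c (suc t + a′))
        ≡⟨ rec t ⟨
      c (suc t + (a′ + b′))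
        ≡⟨ cong₂ (λ σ d → literal σ (c (suc t + (a′ + b′ ∸ d)))) sign-central delay-central ⟨
      value (suc t) central
        ∎

    driven-node : ∀ v → (∀ u → blockOf u < blockOf v → Driven u) → Driven v
    driven-node = cover-elim Step
      (λ { zero    → subst Step (sym node-zeroᵃ) driven-central
         ; (suc j) → EA.node-driven localᵃ-suc c t j (delayᵃ≤ (suc (inject₁ j))) y-value })
      (λ { zero    → subst Step (sym node-zeroᵇ) driven-central
         ; (suc j) → EB.node-driven localᵇ-suc c t j (delayᵇ≤ (suc (inject₁ j))) y-value })
      where
      Step : Fin n → Set
      Step v = (∀ u → blockOf u < blockOf v → Driven u) → Driven v

    -- Edges labelled < read values computed earlier in the same step.
    driven-acc : ∀ v → Acc _<_ (blockOf v) → Driven v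
    driven-acc v (acc rs) = driven-node v (λ u u<v → driven-acc u (rs u<v))

    driven : (F ⟨ Δ ⟩) y ≡ tabulate (value (suc t))
    driven = lookup-injective λ v →
      trans (driven-acc v (<-wellFounded (blockOf v))) (sym (lookup∘tabulate (value (suc t)) v))

  cycles-delayLine : DelayLine (F ⟨ Δ ⟩) σᵃ σᵇ a′ b′
  cycles-delayLine = record
    { central       = central
    ; delay         = delay
    ; polarity      = polarity
    ; delay≤        = delay≤
    ; delay-central = delay-central
    ; sign-central  = sign-central
    ; repeats       = λ x m → cover-elim (Repeats x m) (repeatsᵃ x m) (repeatsᵇ x m)
    ; recurrence    = recurrence
    ; driven        = driven
    }

doubleCycle-delayLine : ∀ {s s′ a b} (D : DC s s′ a b) (Δ : BlockSequential (DC.n D)) →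
  let open DC D in
  DelayLine (network ⟨ Δ ⟩) s s′ (a ∸ #lt network Δ cycleᵃ) (b ∸ #lt network Δ cycleᵇ)
-- A cycle of size zero has no node, yet the central automaton lies on both cycles.
doubleCycle-delayLine {a = zero} D Δ
  with () ← proj₁ (proj₁ (Equivalence.from (DC.intersect D (DC.central D)) refl))
doubleCycle-delayLine {a = suc _} {zero} D Δ
  with () ← proj₁ (proj₂ (Equivalence.from (DC.intersect D (DC.central D)) refl))
doubleCycle-delayLine {a = suc _} {suc _} D Δ =
  subst₂ (DelayLine (DC.network D ⟨ Δ ⟩) _ _) SA.delay-total SB.delay-total
    (subst₂ (λ s s′ → DelayLine (DC.network D ⟨ Δ ⟩) s s′ a′ b′)
      (trans SA.polarity-total signᵃ) (trans SB.polarity-total signᵇ) cycles-delayLine)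
  where
  open DoubleCycle D Δ
  open DC D using (signᵃ; signᵇ)

-- The parallel schedule and the comparison

parallel-≮ : ∀ {n} .{{_ : NonZero n}} (u v : Fin n) → ¬ HasLabel parallel lt u v
parallel-≮ {suc n} u v ()

count-none : ∀ {A : Set} {P : Pred A 0ℓ} (P? : Decidable P) → (∀ x → ¬ P x) →
             ∀ {k} (xs : Vec A k) → count P? xs ≡ 0
count-none P? ¬P []       = refl
count-none P? ¬P (x ∷ xs) rewrite dec-false (P? x) (¬P x) = count-none P? ¬P xs

#lt-parallel : ∀ {n k} .{{_ : NonZero n}} (F : Network n) (C : SignedCycle n k) → #lt F parallel C ≡ 0
#lt-parallel F C = count-none (λ i → updateEdge? F parallel lt (node i) (node (next i)))
  (λ i e → parallel-≮ (node i) (node (next i)) (proj₂ e)) (allFin _)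
  where open SignedCycle C

-- The general result specialised: with a single block no edge is labelled `<`, and `a ∸ 0` computes
-- to `a`.
parallel-delayLine : ∀ {s s′ a b} (D : DC s s′ a b) → let open DC D in
                     DelayLine (network ⟨ parallel {{n-nonZero}} ⟩) s s′ a b
parallel-delayLine {a = a} {b} D =
  subst₂ (λ p q → DelayLine (network ⟨ parallel {{n-nonZero}} ⟩) _ _ (a ∸ p) (b ∸ q))
    (#lt-parallel {{n-nonZero}} network cycleᵃ) (#lt-parallel {{n-nonZero}} network cycleᵇ)
    (doubleCycle-delayLine D (parallel {{n-nonZero}}))
  where open DC D

theorem5 : (s s′ : Sign) (a b : ℕ) (D : DC s s′ a b) (Δ : BlockSequential (DC.n D)) →
    let A = #lt (DC.network D) Δ (DC.cycleᵃ D)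
        B = #lt (DC.network D) Δ (DC.cycleᵇ D)
    in (D′ : DC s s′ (a ∸ A) (b ∸ B)) →
       limitDynamics (DC.network D ⟨ Δ ⟩)
         ≅ limitDynamics (DC.network D′ ⟨ parallel {{DC.n-nonZero D′}} ⟩)
theorem5 s s′ a b D Δ D′ =
  -- Both delay lines have signs `s`, `s′` and lengths `a ∸ A`, `b ∸ B`, which is all that the
  -- equivalence compares.
  limitDynamics-≅ (delayLines-equivalent (doubleCycle-delayLine D Δ) (parallel-delayLine D′))
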